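{- For every integer $n \ge 1$, \[f(n,1) + f(n-1,2) + \cdots = \sum_{d=1}^{n} f(n+1-d,d) = a(n+1).\]
   Context: A partition of a positive integer $n$ is a finite sequence of positive integers $\lambda = (\lambda_1,\ldots,\lambda_j)$ with $\lambda_1 \ge \cdots \ge \lambda_j$ and $\sum_i \lambda_i = n$; the $\lambda_i$ are its parts. For integers $n \ge 1$ and $d \ge 1$, a partition $\lambda$ of $n$ has fixed point $d$ if $\lambda$ has at least $d$ parts and $\lambda_d = d$. Let $f(n,d)$ denote the number of partitions of $n$ with fixed point $d$. The size of the Durfee square of a partition $\lambda$ is the greatest index $i$ for which $\lambda_i \ge i$. Let $a(n)$ be the number of partitions $\lambda$ of $n$ such that the size of the Durfee square of $\lambda$ is not a part of $\lambda$. -}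

module Defs where

open import Data.Empty using (⊥-elim)
open import Data.Fin.Base using (Fin; toℕ; zero; suc)
open import Data.Fin.Properties using (any?)
open import Data.List.Base using (List; []; _∷_; length; lookup; map; concatMap; filter; allFin; applyUpTo)
open import Data.List.Extrema.Nat using (max; xs≤max; argmax-sel)
open import Data.List.Membership.DecPropositional using (_∈?_)
open import Data.List.Membership.Propositional using (_∈_; _∉_; find; lose)
open import Data.List.Membership.Propositional.Properties
  using (∈-concatMap⁺; ∈-concatMap⁻; ∈-filter⁺; ∈-filter⁻; ∈-map⁺; ∈-map⁻; ∈-allFin)
open import Data.List.Relation.Unary.All as All using (All; []; _∷_)
open import Data.List.Relation.Unary.All.Properties using (map⁺)
open import Data.List.Relation.Unary.AllPairs using (AllPairs; []; _∷_)
open import Data.List.Relation.Unary.Any using (here; there)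
open import Data.List.Relation.Unary.Linked using (Linked; linked?)
open import Data.List.Relation.Unary.Unique.Propositional using (Unique)
import Data.List.Relation.Unary.Unique.Propositional.Properties as Uniqueₚ
open import Data.List.Relation.Binary.Disjoint.Propositional using (Disjoint)
open import Data.Nat.Base using (ℕ; zero; suc; _≤_; _≥_; z≤n; s≤s)
open import Data.Nat.ListAction using (sum)
open import Data.Nat.Properties using (_≟_; _≤?_; _≥?_; suc-injective; 1+n≰n)
open import Data.Product.Base using (∃-syntax; _×_; _,_; proj₁; proj₂)
open import Data.Sum.Base using (inj₁; inj₂)
open import Relation.Binary.PropositionalEquality using (_≡_; _≢_; refl; sym; trans; cong; subst)
open import Relation.Nullary.Decidable using (Dec; ¬?; _×-dec_)

record IsPartition (n : ℕ) (p : List ℕ) : Set where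
  constructor isPartition
  field
    positive   : All (1 ≤_) p
    decreasing : Linked _≥_ p
    total      : sum p ≡ n

-- A composition of 1 + n arises from exactly one composition of n, either by
-- prepending a part 1 or by increasing its first part.
extend : List ℕ → List (List ℕ)
extend []       = (1 ∷ []) ∷ []
extend (x ∷ xs) = (1 ∷ x ∷ xs) ∷ (suc x ∷ xs) ∷ []

compositions : ℕ → List (List ℕ)
compositions zero    = [] ∷ []
compositions (suc n) = concatMap extend (compositions n)

-- That this lists each partition of n exactly once is shown by
-- ∈-partitions⁺, ∈-partitions⁻ and partitions-unique below.
partitions : ℕ → List (List ℕ)
partitions n = filter (linked? _≥?_) (compositions n)

-- Parts are indexed from 1, so i : Fin (length p) stands for the index 1 + i.
index : ∀ {n} → Fin n → ℕ
index i = suc (toℕ i)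

HasFixedPoint : ℕ → List ℕ → Set
HasFixedPoint d p = ∃[ i ] (index i ≡ d × lookup p i ≡ d)

hasFixedPoint? : ∀ d p → Dec (HasFixedPoint d p)
hasFixedPoint? d p = any? (λ i → (index i ≟ d) ×-dec (lookup p i ≟ d))

f : ℕ → ℕ → ℕ
f n d = length (filter (hasFixedPoint? d) (partitions n))

-- The bottom value 0 of max is attained only when no index qualifies, which
-- does not happen for a partition of a positive integer; see durfeeSize-attained.
durfeeSize : List ℕ → ℕ
durfeeSize p = max 0 (map index (filter (λ i → index i ≤? lookup p i) (allFin (length p))))

a : ℕ → ℕ
a n = length (filter (λ p → ¬? (_∈?_ _≟_ (durfeeSize p) p)) (partitions n))

∑[1…_] : ℕ → (ℕ → ℕ) → ℕ
∑[1… n ] g = sum (map g (applyUpTo suc n))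

private

  IsComposition : ℕ → List ℕ → Set
  IsComposition n p = All (1 ≤_) p × sum p ≡ n

  extend-sound : ∀ {n p q} → IsComposition n p → q ∈ extend p → IsComposition (suc n) q
  extend-sound {p = []}    (_ , s)        (here refl)         = (s≤s z≤n ∷ []) , cong suc s
  extend-sound {p = _ ∷ _} (pos , s)      (here refl)         = (s≤s z≤n ∷ pos) , cong suc s
  extend-sound {p = _ ∷ _} (_ ∷ pos , s)  (there (here refl)) = (s≤s z≤n ∷ pos) , cong suc s

  compositions-sound : ∀ n {p} → p ∈ compositions n → IsComposition n p
  compositions-sound zero    (here refl) = [] , refl
  compositions-sound (suc n) p∈ with find (∈-concatMap⁻ extend {compositions n} p∈)
  ... | q , q∈ , p∈q = extend-sound (compositions-sound n q∈) p∈q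

  compositions-complete : ∀ n {p} → IsComposition n p → p ∈ compositions n
  compositions-complete zero    {[]}         _              = here refl
  compositions-complete zero    {suc _ ∷ _}  (_ , ())
  compositions-complete zero    {zero ∷ _}   (() ∷ _ , _)
  compositions-complete (suc n) {[]}         (_ , ())
  compositions-complete (suc n) {zero ∷ _}   (() ∷ _ , _)
  compositions-complete (suc n) {suc zero ∷ []} (_ , s) =
    ∈-concatMap⁺ extend (lose (compositions-complete n {[]} ([] , suc-injective s)) (here refl))
  compositions-complete (suc n) {suc zero ∷ x ∷ xs} (_ ∷ pos , s) =
    ∈-concatMap⁺ extend (lose (compositions-complete n {x ∷ xs} (pos , suc-injective s)) (here refl))
  compositions-complete (suc n) {suc (suc x) ∷ xs} (_ ∷ pos , s) =
    ∈-concatMap⁺ extend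
      (lose (compositions-complete n {suc x ∷ xs} (s≤s z≤n ∷ pos , suc-injective s)) (there (here refl)))

  shrink : List ℕ → List ℕ
  shrink (suc (suc x) ∷ xs) = suc x ∷ xs
  shrink (_ ∷ xs)           = xs
  shrink []                 = []

  shrink-extend : ∀ {p q} → All (1 ≤_) p → q ∈ extend p → shrink q ≡ p
  shrink-extend {[]}        _       (here refl)         = refl
  shrink-extend {_ ∷ _}     _       (here refl)         = refl
  shrink-extend {suc _ ∷ _} _       (there (here refl)) = refl
  shrink-extend {zero ∷ _}  (() ∷ _) (there (here refl))

  extend-unique : ∀ {p} → All (1 ≤_) p → Unique (extend p)
  extend-unique {[]}        _ = [] ∷ []
  extend-unique {suc _ ∷ _} _ = ((λ ()) ∷ []) ∷ ([] ∷ [])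
  extend-unique {zero ∷ _}  (() ∷ _)

  extend-disjoint : ∀ {p q} → All (1 ≤_) p → All (1 ≤_) q → p ≢ q → Disjoint (extend p) (extend q)
  extend-disjoint pos pos′ p≢q (r∈p , r∈q) =
    p≢q (trans (sym (shrink-extend pos r∈p)) (shrink-extend pos′ r∈q))

  extend-disjoint-all : ∀ {p qs} → All (1 ≤_) p → All (All (1 ≤_)) qs → All (p ≢_) qs →
                        All (Disjoint (extend p)) (map extend qs)
  extend-disjoint-all pos []             []          = []
  extend-disjoint-all pos (pos′ ∷ poss) (p≢q ∷ p≢qs) =
    extend-disjoint pos pos′ p≢q ∷ extend-disjoint-all pos poss p≢qs

  extends-disjoint : ∀ {ps} → All (All (1 ≤_)) ps → Unique ps → AllPairs Disjoint (map extend ps)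
  extends-disjoint []           []           = []
  extends-disjoint (pos ∷ poss) (p≢ps ∷ ps!) =
    extend-disjoint-all pos poss p≢ps ∷ extends-disjoint poss ps!

  compositions-unique : ∀ n → Unique (compositions n)
  compositions-unique zero    = [] ∷ []
  compositions-unique (suc n) =
    Uniqueₚ.concat⁺ (map⁺ (All.map extend-unique poss)) (extends-disjoint poss (compositions-unique n))
    where
    poss : All (All (1 ≤_)) (compositions n)
    poss = All.tabulate (λ p∈ → proj₁ (compositions-sound n p∈))

∈-partitions⁺ : ∀ {n p} → IsPartition n p → p ∈ partitions n
∈-partitions⁺ (isPartition pos dec s) =
  ∈-filter⁺ (linked? _≥?_) (compositions-complete _ (pos , s)) dec

∈-partitions⁻ : ∀ {n p} → p ∈ partitions n → IsPartition n p
∈-partitions⁻ {n} p∈ with ∈-filter⁻ (linked? _≥?_) {xs = compositions n} p∈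
... | p∈c , dec with compositions-sound n p∈c
...   | pos , s = isPartition pos dec s

partitions-unique : ∀ n → Unique (partitions n)
partitions-unique n = Uniqueₚ.filter⁺ (linked? _≥?_) (compositions-unique n)

durfeeSize-greatest : ∀ p i → index i ≤ lookup p i → index i ≤ durfeeSize p
durfeeSize-greatest p i i≤ =
  All.lookup (xs≤max 0 _) (∈-map⁺ index (∈-filter⁺ (λ i → index i ≤? lookup p i) (∈-allFin i) i≤))

durfeeSize-attained : ∀ {n p} → 1 ≤ n → IsPartition n p →
                      ∃[ i ] (index i ≡ durfeeSize p × index i ≤ lookup p i)
durfeeSize-attained {p = []}     (s≤s _) (isPartition _ _ ())
durfeeSize-attained {p = p@(_ ∷ _)} _ (isPartition (1≤x ∷ _) _ _)
  with argmax-sel (λ x → x) 0 (map index (filter (λ i → index i ≤? lookup p i) (allFin (length p))))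
... | inj₁ ≡0 = ⊥-elim (1+n≰n (subst (1 ≤_) ≡0 (durfeeSize-greatest p zero 1≤x)))
... | inj₂ ∈s with ∈-map⁻ index ∈s
...   | i , i∈ , eq = i , sym eq , proj₂ (∈-filter⁻ (λ i → index i ≤? lookup p i) {xs = allFin (length p)} i∈)

{-# OPTIONS --safe #-}

-- If p has fixed point d, then its conjugate has d-th part at least d and
-- (d+1)-th part less than d. Adding 1 to the first d parts of the conjugate thus
-- gives a partition of |p| + d whose first d parts exceed d and whose other parts
-- are below d: its Durfee square has size d, and d is not a part. Conversely, in
-- a partition of the latter kind the first d parts can be lowered by 1, and
-- conjugating gives back p. Since d is the Durfee size of the image, the maps for
-- different d combine into one bijection.
module Submission where

open import Defs
open import Data.Fin.Base using (zero; suc; toℕ; fromℕ<)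
open import Data.Fin.Properties using (toℕ-fromℕ<)
open import Data.List.Base using (List; []; _∷_; length; lookup; map; concatMap; filter; applyUpTo)
open import Data.List.Properties using (length-++; length-map; map-cong)
open import Data.List.Membership.DecPropositional using (_∈?_)
open import Data.List.Membership.Propositional using (_∈_; _∉_; find; lose)
open import Data.List.Membership.Propositional.Properties
  using (∈-concatMap⁺; ∈-concatMap⁻; ∈-filter⁺; ∈-filter⁻; ∈-map⁺; ∈-map⁻;
         ∈-applyUpTo⁺; ∈-applyUpTo⁻; ∈-lookup)
open import Data.List.Membership.Propositional.Properties.WithK using (unique∧set⇒bag)
open import Data.List.Relation.Binary.BagAndSetEquality using (∼bag⇒↭)
open import Data.List.Relation.Binary.Disjoint.Propositional using (Disjoint)
open import Data.List.Relation.Binary.Permutation.Propositional.Properties using (↭-length)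
open import Data.List.Relation.Unary.All as All using (All; []; _∷_)
import Data.List.Relation.Unary.All.Properties as Allₚ
open import Data.List.Relation.Unary.AllPairs using ([]; _∷_)
import Data.List.Relation.Unary.AllPairs.Properties as AllPairsₚ
open import Data.List.Relation.Unary.Any using (here; there)
open import Data.List.Relation.Unary.Linked as Linked using (Linked; []; [-]; _∷_)
open import Data.List.Relation.Unary.Unique.Propositional using (Unique)
import Data.List.Relation.Unary.Unique.Propositional.Properties as Uniqueₚ
open import Data.Nat.Base using (ℕ; zero; suc; _+_; _∸_; _≤_; _<_; _≮_; _≥_; z≤n; s≤s; z<s; s≤s⁻¹)
open import Data.Nat.ListAction using (sum)
open import Data.Nat.Properties
open import Algebra.Properties.CommutativeSemigroup +-commutativeSemigroup using (x∙yz≈y∙xz)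
open import Data.Product.Base using (∃-syntax; _×_; _,_; proj₁)
open import Data.Sum.Base using (inj₁; inj₂)
open import Function.Base using (_∘_)
open import Function.Bundles using (_⇔_; mk⇔)
open import Relation.Binary.PropositionalEquality
  using (_≡_; _≢_; refl; sym; trans; cong; cong₂; subst; module ≡-Reasoning)
open import Relation.Nullary.Decidable using (¬?; yes; no)
open import Relation.Nullary.Negation using (contradiction)

-- Parts by index, padded with zeros

-- Parts are indexed from 0 here, and part p i is 0 beyond the last part.
part : List ℕ → ℕ → ℕ
part []       _       = 0
part (x ∷ _)  zero    = x
part (_ ∷ xs) (suc i) = part xs i

part-lookup : ∀ p i → part p (toℕ i) ≡ lookup p i
part-lookup (_ ∷ _) zero    = refl
part-lookup (_ ∷ p) (suc i) = part-lookup p i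

part>0⇒<length : ∀ p i → 0 < part p i → i < length p
part>0⇒<length (_ ∷ _) zero    _  = z<s
part>0⇒<length (_ ∷ p) (suc i) 0< = s≤s (part>0⇒<length p i 0<)

lookup-part : ∀ p i → 0 < part p i → ∃[ j ] (toℕ j ≡ i × lookup p j ≡ part p i)
lookup-part p i 0< = fromℕ< i< , eq , trans (sym (part-lookup p (fromℕ< i<))) (cong (part p) eq)
  where
  i< = part>0⇒<length p i 0<
  eq = toℕ-fromℕ< i<

∈⇒part : ∀ {x p} → x ∈ p → ∃[ i ] part p i ≡ x
∈⇒part (here refl) = 0 , refl
∈⇒part (there x∈)  with ∈⇒part x∈
... | i , eq = suc i , eq

part≤sum : ∀ p i → part p i ≤ sum p
part≤sum []      _       = z≤n
part≤sum (x ∷ p) zero    = m≤m+n x (sum p)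
part≤sum (x ∷ p) (suc i) = ≤-trans (part≤sum p i) (m≤n+m (sum p) x)

part-antitone : ∀ {p i j} → Linked _≥_ p → i ≤ j → part p j ≤ part p i
part-antitone                     []        _         = z≤n
part-antitone {j = zero}          [-]       z≤n       = ≤-refl
part-antitone {j = suc _}         [-]       _         = z≤n
part-antitone {j = zero}          (_ ∷ _)   z≤n       = ≤-refl
part-antitone {i = zero} {suc j}  (x≥y ∷ l) z≤n       = ≤-trans (part-antitone {j = j} l z≤n) x≥y
part-antitone                     (_ ∷ l)   (s≤s i≤j) = part-antitone l i≤j

-- Positive parts make the default 0 of `part` mark the end of the list, so the lengths agree as
-- well.
part-injective : ∀ {p q} → All (1 ≤_) p → All (1 ≤_) q → (∀ i → part p i ≡ part q i) → p ≡ q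
part-injective []         []         _  = refl
part-injective []         (1≤y ∷ _)  eq = contradiction (eq 0) (<⇒≢ 1≤y)
part-injective (1≤x ∷ _)  []         eq = contradiction (sym (eq 0)) (<⇒≢ 1≤x)
part-injective (_ ∷ pos)  (_ ∷ pos′) eq = cong₂ _∷_ (eq 0) (part-injective pos pos′ (eq ∘ suc))

linked-∷ : ∀ {x} p → part p 0 ≤ x → Linked _≥_ p → Linked _≥_ (x ∷ p)
linked-∷ []      _   _ = [-]
linked-∷ (_ ∷ _) y≤x l = y≤x ∷ l

-- Adding 1 to the first parts

-- Missing parts count as 0. In the Young diagram this inserts a column of height `k`, which serves
-- both to build conjugates and to enlarge them.
raise : ℕ → List ℕ → List ℕ
raise zero    p       = p
raise (suc k) []      = 1 ∷ raise k []
raise (suc k) (x ∷ p) = suc x ∷ raise k p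

part-raise-< : ∀ {j k} p → j < k → part (raise k p) j ≡ suc (part p j)
part-raise-< {zero}  {suc k} []      _         = refl
part-raise-< {zero}  {suc k} (_ ∷ _) _         = refl
part-raise-< {suc j} {suc k} []      (s≤s j<k) = part-raise-< [] j<k
part-raise-< {suc j} {suc k} (_ ∷ p) (s≤s j<k) = part-raise-< p j<k

part-raise-≥ : ∀ {j k} p → k ≤ j → part (raise k p) j ≡ part p j
part-raise-≥ {j}     {zero}  _       _         = refl
part-raise-≥ {suc j} {suc k} []      (s≤s k≤j) = part-raise-≥ [] k≤j
part-raise-≥ {suc j} {suc k} (_ ∷ p) (s≤s k≤j) = part-raise-≥ p k≤j

part-raise-≤ : ∀ k p j → part (raise k p) j ≤ suc (part p j)
part-raise-≤ k p j with j <? k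
... | yes j<k = ≤-reflexive (part-raise-< p j<k)
... | no  j≮k = m≤n⇒m≤1+n (≤-reflexive (part-raise-≥ p (≮⇒≥ j≮k)))

raise-positive : ∀ k {p} → All (1 ≤_) p → All (1 ≤_) (raise k p)
raise-positive zero    pos       = pos
raise-positive (suc k) []        = z<s ∷ raise-positive k []
raise-positive (suc k) (_ ∷ pos) = z<s ∷ raise-positive k pos

raise-decreasing : ∀ k {p} → Linked _≥_ p → Linked _≥_ (raise k p)
raise-decreasing zero    l = l
raise-decreasing (suc k) {[]} l =
  linked-∷ (raise k []) (part-raise-≤ k [] 0) (raise-decreasing k [])
raise-decreasing (suc k) {x ∷ p} l =
  linked-∷ (raise k p)
    (≤-trans (part-raise-≤ k p 0) (s≤s (part-antitone {i = 0} {1} l z≤n)))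
    (raise-decreasing k (Linked.tail l))

sum-raise : ∀ k p → sum (raise k p) ≡ k + sum p
sum-raise zero    p       = refl
sum-raise (suc k) []      = cong suc (sum-raise k [])
sum-raise (suc k) (x ∷ p) = cong suc (trans (cong (x +_) (sum-raise k p)) (x∙yz≈y∙xz x k (sum p)))

-- Positivity matters here: a trailing 0 would be confused with a missing part, as in
-- `raise 1 [] ≡ raise 1 (0 ∷ [])`.
raise-injective : ∀ k {p q} → All (1 ≤_) p → All (1 ≤_) q → raise k p ≡ raise k q → p ≡ q
raise-injective k {p} {q} pos pos′ eq = part-injective pos pos′ parts
  where
  parts : ∀ j → part p j ≡ part q j
  parts j with j <? k
  ... | yes j<k = suc-injective (trans (sym (part-raise-< p j<k))
                    (trans (cong (λ r → part r j) eq) (part-raise-< q j<k)))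
  ... | no  j≮k = trans (sym (part-raise-≥ p (≮⇒≥ j≮k)))
                    (trans (cong (λ r → part r j) eq) (part-raise-≥ q (≮⇒≥ j≮k)))

-- The strict drop after the first 1 + k parts keeps the list decreasing once
-- these parts are lowered by 1.
unraise : ∀ k {q} → All (1 ≤_) q → Linked _≥_ q → part q (suc k) < part q k → 1 < part q k →
          ∃[ r ] (All (1 ≤_) r × Linked _≥_ r × raise (suc k) r ≡ q)
unraise zero {suc x ∷ q} (_ ∷ pos) l drop 1< =
  x ∷ q , s≤s⁻¹ 1< ∷ pos , linked-∷ q (s≤s⁻¹ drop) (Linked.tail l) , refl
unraise (suc k) {suc x ∷ q} (_ ∷ pos) l drop 1< with unraise k pos (Linked.tail l) drop 1<
... | r , pos′ , l′ , refl =
  x ∷ r ,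
  -- The head is at least the last part to be lowered, which exceeds 1, so it stays positive.
  s≤s⁻¹ (≤-trans 1< (part-antitone {i = 0} {suc k} l z≤n)) ∷ pos′ ,
  linked-∷ r (s≤s⁻¹ (subst (_≤ suc x) (part-raise-< r z<s) (part-antitone {i = 0} {1} l z≤n))) l′ ,
  refl

-- Conjugation

-- A row of length `x` contributes one cell to each of the first `x` columns.
conjugate : List ℕ → List ℕ
conjugate []      = []
conjugate (x ∷ p) = raise x (conjugate p)

conjugate-positive : ∀ p → All (1 ≤_) (conjugate p)
conjugate-positive []      = []
conjugate-positive (x ∷ p) = raise-positive x (conjugate-positive p)

conjugate-decreasing : ∀ p → Linked _≥_ (conjugate p)
conjugate-decreasing []      = []
conjugate-decreasing (x ∷ p) = raise-decreasing x (conjugate-decreasing p)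

sum-conjugate : ∀ p → sum (conjugate p) ≡ sum p
sum-conjugate []      = refl
sum-conjugate (x ∷ p) = trans (sum-raise x (conjugate p)) (cong (x +_) (sum-conjugate p))

-- Both sides say that the cell (i , j) lies in the Young diagram of p.
<part⇒<part-conjugate : ∀ {p} i j → Linked _≥_ p → j < part p i → i < part (conjugate p) j
<part⇒<part-conjugate {x ∷ p} zero    j l j< =
  subst (0 <_) (sym (part-raise-< (conjugate p) j<)) z<s
<part⇒<part-conjugate {x ∷ p} (suc i) j l j< =
  subst (suc i <_) (sym (part-raise-< (conjugate p) (<-≤-trans j< (part-antitone {i = 0} {suc i} l z≤n))))
    (s≤s (<part⇒<part-conjugate i j (Linked.tail l) j<))

<part-conjugate⇒<part : ∀ {p} i j → Linked _≥_ p → i < part (conjugate p) j → j < part p i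
<part-conjugate⇒<part {x ∷ p} i j l i< with j <? x
<part-conjugate⇒<part {x ∷ p} zero    j l i< | yes j<x = j<x
<part-conjugate⇒<part {x ∷ p} (suc i) j l i< | yes j<x =
  <part-conjugate⇒<part i j (Linked.tail l)
    (s≤s⁻¹ (subst (suc i <_) (part-raise-< (conjugate p) j<x) i<))
-- The first row does not reach column `j`, so a cell there would lie in a later row; that row, and
-- with it the first, would then be longer than `j`.
... | no j≮x = contradiction j<x j≮x
  where
  0<part : 0 < part (conjugate p) j
  0<part = subst (0 <_) (part-raise-≥ (conjugate p) (≮⇒≥ j≮x)) (≤-<-trans z≤n i<)
  j<x : j < x
  j<x = <-≤-trans (<part-conjugate⇒<part 0 j (Linked.tail l) 0<part) (part-antitone {i = 0} {1} l z≤n)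

≡-from-< : ∀ {m n} → (∀ {j} → j < m → j < n) → (∀ {j} → j < n → j < m) → m ≡ n
≡-from-< {m} {n} f g = ≤-antisym (≮⇒≥ (<-irrefl refl ∘ f)) (≮⇒≥ (<-irrefl refl ∘ g))

-- Reflecting a cell twice returns it, so corresponding rows contain the same cells.
conjugate-involutive : ∀ {p} → All (1 ≤_) p → Linked _≥_ p → conjugate (conjugate p) ≡ p
conjugate-involutive {p} pos l =
  part-injective (conjugate-positive (conjugate p)) pos λ i → ≡-from-<
    (λ {j} → <part-conjugate⇒<part i j l ∘ <part-conjugate⇒<part j i (conjugate-decreasing p))
    (λ {j} → <part⇒<part-conjugate j i (conjugate-decreasing p) ∘ <part⇒<part-conjugate i j l)

-- Fixed points and Durfee squares in terms of `part`

fixedPoint⇒part : ∀ {k} p → HasFixedPoint (suc k) p → part p k ≡ suc k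
fixedPoint⇒part p (i , refl , eq) = trans (part-lookup p i) eq

part⇒fixedPoint : ∀ {k} p → part p k ≡ suc k → HasFixedPoint (suc k) p
part⇒fixedPoint {k} p eq with lookup-part p k (subst (0 <_) (sym eq) z<s)
... | i , refl , eq′ = i , refl , trans eq′ eq

≤part⇒≤durfeeSize : ∀ p k → suc k ≤ part p k → suc k ≤ durfeeSize p
≤part⇒≤durfeeSize p k k< with lookup-part p k (≤-trans z<s k<)
... | i , refl , eq = durfeeSize-greatest p i (subst (index i ≤_) (sym eq) k<)

durfeeSize-attained′ : ∀ {n p} → 1 ≤ n → IsPartition n p →
                       ∃[ k ] (durfeeSize p ≡ suc k × suc k ≤ part p k)
durfeeSize-attained′ {p = p} 1≤n isP with durfeeSize-attained 1≤n isP
... | i , eq , i≤ = toℕ i , sym eq , subst (index i ≤_) (sym (part-lookup p i)) i≤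

part∈ : ∀ p i → 0 < part p i → part p i ∈ p
part∈ p i 0< with lookup-part p i 0<
... | j , _ , eq = subst (_∈ p) eq (∈-lookup j)

-- As parts are indexed from 0, Gap k says that the first 1 + k parts exceed 1 + k
-- and that the others are smaller than 1 + k.
Gap : ℕ → List ℕ → Set
Gap k q = suc (suc k) ≤ part q k × part q (suc k) ≤ k

-- For Durfee size `suc k`, attainment gives `suc k ≤ part q k` and maximality gives
-- `part q (suc k) ≤ suc k`; equality in either would make the size a part.
durfeeSize∉⇒gap : ∀ {n q} → 1 ≤ n → IsPartition n q → durfeeSize q ∉ q → ∃[ k ] Gap k q
durfeeSize∉⇒gap {q = q} 1≤n isQ ∉q with durfeeSize-attained′ 1≤n isQ
... | k , eq , k< = k , ≤∧≢⇒< k< (missing k (≤-trans z<s k<) ∘ sym) , s≤s⁻¹ below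
  where
  missing : ∀ i → 0 < part q i → part q i ≢ suc k
  missing i 0< eq′ = ∉q (subst (_∈ q) (trans eq′ (sym eq)) (part∈ q i 0<))

  below : part q (suc k) < suc k
  below with m≤n⇒m<n∨m≡n (≮⇒≥ λ k<′ → 1+n≰n (subst (suc (suc k) ≤_) eq (≤part⇒≤durfeeSize q (suc k) k<′)))
  ... | inj₁ lt  = lt
  ... | inj₂ eq′ = contradiction eq′ (missing (suc k) (subst (0 <_) (sym eq′) z<s))

gap⇒durfeeSize : ∀ {n k q} → 1 ≤ n → IsPartition n q → Gap k q → durfeeSize q ≡ suc k
gap⇒durfeeSize {k = k} {q} 1≤n isQ (large , small) with durfeeSize-attained′ 1≤n isQ
... | j , eq , j< = ≤-antisym (subst (_≤ suc k) (sym eq) (s≤s (≮⇒≥ k≮j))) (≤part⇒≤durfeeSize q k (<⇒≤ large))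
  where
  k≮j : k ≮ j
  -- A Durfee square of size `suc j` beyond `suc k` would give `j < part q j ≤ part q (suc k) ≤ k`.
  k≮j k<j = <-asym k<j
    (≤-trans j< (≤-trans (part-antitone (IsPartition.decreasing isQ) k<j) small))

gap⇒∉ : ∀ {k q} → Linked _≥_ q → Gap k q → suc k ∉ q
gap⇒∉ {k} l (large , small) ∈q with ∈⇒part ∈q
... | i , eq with i ≤? k
...   | yes i≤k = 1+n≰n (≤-trans large (≤-trans (part-antitone l i≤k) (≤-reflexive eq)))
...   | no  i≰k = 1+n≰n (≤-trans (≤-reflexive (sym eq)) (≤-trans (part-antitone l (≰⇒> i≰k)) small))

-- The bijection

stretch : ℕ → List ℕ → List ℕ
stretch d p = raise d (conjugate p)

stretch-injective : ∀ d {m n p q} → IsPartition m p → IsPartition n q → stretch d p ≡ stretch d q → p ≡ q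
stretch-injective d {p = p} {q} (isPartition pos l _) (isPartition pos′ l′ _) eq = begin
  p                        ≡⟨ conjugate-involutive pos l ⟨
  conjugate (conjugate p)  ≡⟨ cong conjugate (raise-injective d (conjugate-positive p) (conjugate-positive q) eq) ⟩
  conjugate (conjugate q)  ≡⟨ conjugate-involutive pos′ l′ ⟩
  q                        ∎
  where open ≡-Reasoning

stretch-isPartition : ∀ d {n p} → IsPartition n p → IsPartition (d + n) (stretch d p)
stretch-isPartition d {p = p} (isPartition _ _ refl) = isPartition
  (raise-positive d (conjugate-positive p))
  (raise-decreasing d (conjugate-decreasing p))
  (trans (sum-raise d (conjugate p)) (cong (d +_) (sum-conjugate p)))

-- Row `k` of `p` contains the cell in column `k` but not the one in column `suc k`. So column `k`
-- is longer than `k` and column `suc k` is not, and only the former is raised.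
stretch-gap : ∀ {k p} → Linked _≥_ p → part p k ≡ suc k → Gap k (stretch (suc k) p)
stretch-gap {k} {p} l eq =
  subst (suc (suc k) ≤_) (sym (part-raise-< (conjugate p) ≤-refl))
    (s≤s (<part⇒<part-conjugate k k l (≤-reflexive (sym eq)))) ,
  subst (_≤ k) (sym (part-raise-≥ (conjugate p) ≤-refl))
    (≮⇒≥ λ k< → <-irrefl (sym eq) (<part-conjugate⇒<part k (suc k) l k<))

stretch-surjective : ∀ {n k q} → IsPartition n q → Gap k q →
                     ∃[ p ] (IsPartition (n ∸ suc k) p × part p k ≡ suc k × stretch (suc k) p ≡ q)
stretch-surjective {k = k} {q} (isPartition pos l refl) (large , small)
  with unraise k pos l (≤-trans (s≤s small) (<⇒≤ large)) (≤-trans (s≤s z<s) large)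
... | r , pos′ , l′ , refl =
  conjugate r ,
  isPartition (conjugate-positive r) (conjugate-decreasing r) total ,
  -- The same two cells, read backwards: the gap bounds parts `k` and `suc k` of `r`, and
  -- conjugation turns these into the two bounds on row `k`.
  ≤-antisym
    (≮⇒≥ λ k< → 1+n≰n (≤-trans (<part-conjugate⇒<part (suc k) k l′ k<)
                         (subst (_≤ k) (part-raise-≥ r ≤-refl) small)))
    (<part⇒<part-conjugate k k l′ (s≤s⁻¹ (subst (suc (suc k) ≤_) (part-raise-< r ≤-refl) large))) ,
  cong (raise (suc k)) (conjugate-involutive pos′ l′)
  where
  open ≡-Reasoning
  total : sum (conjugate r) ≡ sum (raise (suc k) r) ∸ suc k
  total = begin
    sum (conjugate r)              ≡⟨ sum-conjugate r ⟩
    sum r                          ≡⟨ m+n∸m≡n (suc k) (sum r) ⟨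
    suc k + sum r ∸ suc k          ≡⟨ cong (_∸ suc k) (sum-raise (suc k) r) ⟨
    sum (raise (suc k) r) ∸ suc k  ∎

-- Counting

length-concatMap : ∀ {A B : Set} (g : A → List B) xs → length (concatMap g xs) ≡ sum (map (length ∘ g) xs)
length-concatMap g []       = refl
length-concatMap g (x ∷ xs) = trans (length-++ (g x)) (cong (length (g x) +_) (length-concatMap g xs))

-- Injectivity is asked on members only, since `stretch d` is shown injective on partitions, not on
-- all lists.
unique-map⁺ : ∀ {A B : Set} {g : A → B} {xs} → (∀ {x y} → x ∈ xs → y ∈ xs → g x ≡ g y → x ≡ y) →
              Unique xs → Unique (map g xs)
unique-map⁺ inj []          = []
unique-map⁺ inj (x≢ ∷ xs!) =
  Allₚ.map⁺ (All.tabulate λ y∈ eq → All.lookup x≢ y∈ (inj (here refl) (there y∈) eq)) ∷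
  unique-map⁺ (λ x∈ y∈ → inj (there x∈) (there y∈)) xs!

-- Without repetitions, equal membership means equal multiplicities, so the lists are permutations
-- of each other.
length-unique : ∀ {A : Set} {xs ys : List A} → Unique xs → Unique ys → (∀ {x} → x ∈ xs ⇔ x ∈ ys) →
                length xs ≡ length ys
length-unique xs! ys! same = ↭-length (∼bag⇒↭ (unique∧set⇒bag xs! ys! same))

-- Here `m` is the size after stretching, which adds `d` cells.
fixed : ℕ → ℕ → List (List ℕ)
fixed m d = filter (hasFixedPoint? d) (partitions (m ∸ d))

stretched : ℕ → ℕ → List (List ℕ)
stretched m d = map (stretch d) (fixed m d)

∈-fixed⁻ : ∀ m d {p} → p ∈ fixed m d → IsPartition (m ∸ d) p × HasFixedPoint d p
∈-fixed⁻ m d p∈ with ∈-filter⁻ (hasFixedPoint? d) {xs = partitions (m ∸ d)} p∈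
... | p∈′ , fp = ∈-partitions⁻ p∈′ , fp

stretched-unique : ∀ m d → Unique (stretched m d)
stretched-unique m d = unique-map⁺
  (λ p∈ q∈ → stretch-injective d (proj₁ (∈-fixed⁻ m d p∈)) (proj₁ (∈-fixed⁻ m d q∈)))
  (Uniqueₚ.filter⁺ (hasFixedPoint? d) (partitions-unique (m ∸ d)))

∈-stretched⁻ : ∀ {m k q} → suc k ≤ m → q ∈ stretched m (suc k) → IsPartition m q × Gap k q
∈-stretched⁻ {m} {k} k<m q∈ with ∈-map⁻ (stretch (suc k)) q∈
... | p , p∈ , refl with ∈-fixed⁻ m (suc k) p∈
...   | isP , fp =
  -- Since `suc k ≤ m`, the subtraction in `m ∸ suc k` is not truncated.
  subst (λ n → IsPartition n (stretch (suc k) p)) (m+[n∸m]≡n k<m) (stretch-isPartition (suc k) isP) ,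
  stretch-gap (IsPartition.decreasing isP) (fixedPoint⇒part p fp)

∈-stretched⁺ : ∀ {m k q} → IsPartition m q → Gap k q → q ∈ stretched m (suc k)
∈-stretched⁺ {m} {k} isQ gap with stretch-surjective isQ gap
... | p , isP , eq , refl =
  ∈-map⁺ (stretch (suc k)) (∈-filter⁺ (hasFixedPoint? (suc k)) (∈-partitions⁺ isP) (part⇒fixedPoint p eq))

durfeeAbsent : ℕ → List (List ℕ)
durfeeAbsent m = filter (λ p → ¬? (_∈?_ _≟_ (durfeeSize p) p)) (partitions m)

∈-durfeeAbsent⁻ : ∀ {m q} → 1 ≤ m → q ∈ durfeeAbsent m → IsPartition m q × ∃[ k ] Gap k q
∈-durfeeAbsent⁻ {m} 1≤m q∈
  with ∈-filter⁻ (λ p → ¬? (_∈?_ _≟_ (durfeeSize p) p)) {xs = partitions m} q∈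
... | q∈′ , ∉q = ∈-partitions⁻ q∈′ , durfeeSize∉⇒gap 1≤m (∈-partitions⁻ q∈′) ∉q

∈-durfeeAbsent⁺ : ∀ {m k q} → 1 ≤ m → IsPartition m q → Gap k q → q ∈ durfeeAbsent m
∈-durfeeAbsent⁺ {q = q} 1≤m isQ gap =
  ∈-filter⁺ (λ p → ¬? (_∈?_ _≟_ (durfeeSize p) p)) (∈-partitions⁺ isQ)
    (subst (_∉ q) (sym (gap⇒durfeeSize 1≤m isQ gap)) (gap⇒∉ (IsPartition.decreasing isQ) gap))

module _ (n : ℕ) where

  allStretched : List (List ℕ)
  allStretched = concatMap (stretched (suc n)) (applyUpTo suc n)

  -- The index of a stretched list is the Durfee size of each of its members.
  disjoint : ∀ {i j} → i < j → j < n → Disjoint (stretched (suc n) (suc i)) (stretched (suc n) (suc j))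
  disjoint {i} {j} i<j j<n (q∈ , q∈′)
    with ∈-stretched⁻ (m≤n⇒m≤1+n (<-trans i<j j<n)) q∈ | ∈-stretched⁻ (m≤n⇒m≤1+n j<n) q∈′
  ... | isQ , gap | isQ′ , gap′ =
    <⇒≢ (s≤s i<j) (trans (sym (gap⇒durfeeSize z<s isQ gap)) (gap⇒durfeeSize z<s isQ′ gap′))

  allStretched-unique : Unique allStretched
  allStretched-unique = Uniqueₚ.concat⁺
    (Allₚ.map⁺ (All.tabulate λ {d} _ → stretched-unique (suc n) d))
    (AllPairsₚ.map⁺ (AllPairsₚ.applyUpTo⁺₁ suc n disjoint))

  -- This puts `d = suc k` in the range of summation: some part is at least `suc (suc k)`, and no
  -- part exceeds `suc n`.
  gap⇒<n : ∀ {k q} → IsPartition (suc n) q → Gap k q → k < n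
  gap⇒<n {k} {q} (isPartition _ _ total) (large , _) =
    s≤s⁻¹ (≤-trans large (subst (part q k ≤_) total (part≤sum q k)))

  allStretched⇔durfeeAbsent : ∀ {q} → q ∈ allStretched ⇔ q ∈ durfeeAbsent (suc n)
  allStretched⇔durfeeAbsent {q} = mk⇔ forward backward
    where
    forward : q ∈ allStretched → q ∈ durfeeAbsent (suc n)
    forward q∈ with find (∈-concatMap⁻ (stretched (suc n)) {xs = applyUpTo suc n} q∈)
    ... | d , d∈ , q∈′ with ∈-applyUpTo⁻ suc d∈
    ...   | k , k<n , refl with ∈-stretched⁻ (m≤n⇒m≤1+n k<n) q∈′
    ...     | isQ , gap = ∈-durfeeAbsent⁺ z<s isQ gap

    backward : q ∈ durfeeAbsent (suc n) → q ∈ allStretched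
    backward q∈ =
      let isQ , k , gap = ∈-durfeeAbsent⁻ z<s q∈ in
      ∈-concatMap⁺ (stretched (suc n))
        (lose {P = λ d → q ∈ stretched (suc n) d}
          (∈-applyUpTo⁺ suc (gap⇒<n isQ gap)) (∈-stretched⁺ {suc n} {k} isQ gap))

theorem1p2 : ∀ (n : ℕ) → 1 ≤ n → ∑[1… n ] (λ d → f (n + 1 ∸ d) d) ≡ a (n + 1)
theorem1p2 n _ rewrite +-comm n 1 = begin
  ∑[1… n ] (λ d → f (suc n ∸ d) d)
    -- Mapping preserves length, so each summand also counts stretched partitions, all of size
    -- `suc n`.
    ≡⟨ cong sum (map-cong (λ d → length-map (stretch d) (fixed (suc n) d)) (applyUpTo suc n)) ⟨
  ∑[1… n ] (length ∘ stretched (suc n))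
    ≡⟨ length-concatMap (stretched (suc n)) (applyUpTo suc n) ⟨
  length (allStretched n)
    ≡⟨ length-unique (allStretched-unique n)
         (Uniqueₚ.filter⁺ (λ p → ¬? (_∈?_ _≟_ (durfeeSize p) p)) (partitions-unique (suc n)))
         (allStretched⇔durfeeAbsent n) ⟩
  a (suc n) ∎
  where open ≡-Reasoning
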